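{- In the locker room problem with $n$ lockers, there is a strategy for Alice and Bob such that, for every sought number $s\in\{0,\dots,n-1\}$, Bob finds card $s$ with probability at least $$\frac{(1+o(1))\,\log n}{n\,\log\log n},$$ where $o(1)$ denotes a quantity depending only on $n$ and tending to $0$ as $n\to\infty$.
   Context: $\log=\log_2$. Locker room problem: there are $n$ lockers numbered $0,\dots,n-1$, into which $n$ cards numbered $0,\dots,n-1$ are placed, one per locker, according to a uniformly random permutation $\sigma$ (locker $\ell$ contains card $\sigma(\ell)$). Alice sees the contents of all lockers and may then swap the cards of one pair of lockers, or leave everything unchanged; she does not know $s$. Then Bob, who does not know $\sigma$, is given $s\in\{0,\dots,n-1\}$ and may open at most two lockers, the choice of the second being allowed to depend on $s$ and on the card seen in the first. Bob succeeds if one of the opened lockers contains card $s$. Alice and Bob agree on a strategy (Alice's swap as a function of $\sigma$; Bob's first locker as a function of $s$; Bob's second locker as a function of $s$ and the card seen in the first locker) beforehand. The probability is over $\sigma$ and any randomness of the strategy. -}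

module Defs where

open import Data.Nat as ℕ using (ℕ; suc; _!; NonZero)
open import Data.Nat.Properties using (m*n≢0; _!≢0)
open import Data.Integer as ℤ using (ℤ; +_; -[1+_])
open import Data.Rational using (ℚ; _+_; _*_; _<_; _/_; ∣_∣; 0ℚ; 1ℚ; ½; ↥_; ↧ₙ_)
open import Data.Rational.Properties using (+-*-rawSemiring)
open import Algebra.Definitions.RawSemiring +-*-rawSemiring using (_^_)
open import Data.Fin using (Fin)
open import Data.Fin.Properties using (_≟_)
open import Data.List using (List; []; [_]; length; filter; allFin; cartesianProduct; cartesianProductWith)
open import Data.Vec using (Vec; []; _∷_; lookup; _[_]≔_)
open import Data.Vec.Relation.Unary.Unique.Propositional using (Unique)
open import Data.Vec.Relation.Unary.AllPairs using (allPairs?)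
open import Data.Product using (Σ; ∃; _×_; _,_; proj₁; proj₂)
open import Data.Sum using (_⊎_)
open import Relation.Nullary using (Dec; ¬?)
open import Relation.Nullary.Decidable using (_⊎-dec_)
open import Relation.Binary.PropositionalEquality using (_≡_)

infixl 7 _*ᶜ_ _/ᶜ_
infix  4 _≤ᶜ_

------------------------------------------------------------------------
-- Real numbers

-- A real x is represented by its Dedekind cut: lower x q means q < x and
-- upper x q means x < q.  The cut axioms are not part of the record; they
-- hold for the rationals ι q and are preserved by the operations below on
-- their stated domains.

record Cut : Set₁ where
  field
    lower upper : ℚ → Set

open Cut public

ι : ℚ → Cut
ι p .lower q = q < p
ι p .upper q = p < q

_≤ᶜ_ : Cut → Cut → Set
x ≤ᶜ y = ∀ q → lower x q → lower y q

-- Interval multiplication: if x ∈ (a , b) and y ∈ (c , d), then xy lies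
-- between the least and the greatest of ac, ad, bc, bd.

_*ᶜ_ : Cut → Cut → Cut
(x *ᶜ y) .lower q = ∃ λ a → ∃ λ b → ∃ λ c → ∃ λ d →
  (lower x a × upper x b × lower y c × upper y d) ×
  (q < a * c × q < a * d × q < b * c × q < b * d)
(x *ᶜ y) .upper q = ∃ λ a → ∃ λ b → ∃ λ c → ∃ λ d →
  (lower x a × upper x b × lower y c × upper y d) ×
  (a * c < q × a * d < q × b * c < q × b * d < q)

-- Domain: x > 0.

recip : Cut → Cut
recip x .lower q = ∃ λ u → upper x u × q * u < 1ℚ
recip x .upper q = ∃ λ l → 0ℚ < l × lower x l × 1ℚ < q * l

-- Domain: y > 0.

_/ᶜ_ : Cut → Cut → Cut
x /ᶜ y = x *ᶜ recip y

2^ : ℤ → ℚ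
2^ (+ k)    = (1ℚ + 1ℚ) ^ k
2^ -[1+ k ] = ½ ^ suc k

-- Base-2 logarithm; domain: x > 0.  For q = a / b, the inequality q < log₂ x
-- says 2^(a/b) < x, that is, 2^(a/b) < r < x for some rational r, and
-- 2^(a/b) < r is 2^a < r^b for r > 0; similarly for the upper cut.

log₂ : Cut → Cut
log₂ x .lower q = ∃ λ r → 0ℚ < r × lower x r × 2^ (↥ q) < r ^ (↧ₙ q)
log₂ x .upper q = ∃ λ r → 0ℚ < r × upper x r × r ^ (↧ₙ q) < 2^ (↥ q)

TendsToZero : (ℕ → ℚ) → Set
TendsToZero e = ∀ ε → 0ℚ < ε → ∃ λ N → ∀ n → N ℕ.≤ n → ∣ e n ∣ < ε

-- (1 + e) log n / (n log log n); domain: n ≥ 3, so that log log n > 0.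

bound : ℚ → ℕ → Cut
bound e n = (ι (1ℚ + e) *ᶜ log₂ n′) /ᶜ (n′ *ᶜ log₂ (log₂ n′))
  where n′ = ι (+ n / 1)

------------------------------------------------------------------------
-- The locker room

-- Entry ℓ is the card in locker ℓ.

Contents : ℕ → Set
Contents n = Vec (Fin n) n

allVecs : ∀ n m → List (Vec (Fin n) m)
allVecs n ℕ.zero  = [ [] ]
allVecs n (suc m) = cartesianProductWith _∷_ (allFin n) (allVecs n m)

unique? : ∀ {n m} (v : Vec (Fin n) m) → Dec (Unique v)
unique? = allPairs? λ i j → ¬? (i ≟ j)

-- The n ! permutations of Fin n, each listed once.

permutations : ∀ n → List (Contents n)
permutations n = filter unique? (allVecs n n)

-- alice returns the two lockers whose cards are swapped; returning the same
-- locker twice leaves everything unchanged.  Likewise Bob opens only one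
-- locker if second repeats first.

record Strategy (n : ℕ) : Set where
  field
    alice  : Contents n → Fin n × Fin n
    first  : (s : Fin n) → Fin n
    second : (s card : Fin n) → Fin n

open Strategy public

swap : ∀ {n} → Fin n × Fin n → Contents n → Contents n
swap (i , j) σ = (σ [ i ]≔ lookup σ j) [ j ]≔ lookup σ i

Finds : ∀ {n} → Strategy n → Fin n → Contents n → Set
Finds S s σ = card₁ ≡ s ⊎ lookup τ (second S s card₁) ≡ s
  where
  τ     = swap (alice S σ) σ
  card₁ = lookup τ (first S s)

finds? : ∀ {n} (S : Strategy n) s σ → Dec (Finds S s σ)
finds? S s σ = (_ ≟ s) ⊎-dec (_ ≟ s)

-- A possibly randomized strategy: Alice and Bob draw one of finitely many
-- deterministic strategies uniformly at random beforehand, independently of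
-- the permutation.  Deterministic strategies are the case seeds = 1.

record RandomizedStrategy (n : ℕ) : Set where
  field
    seeds        : ℕ
    seedsNonZero : NonZero seeds
    play         : Fin seeds → Strategy n

module _ {n} (R : RandomizedStrategy n) (s : Fin n) where
  open RandomizedStrategy R

  successes : List (Fin seeds × Contents n)
  successes = filter (λ (k , σ) → finds? (play k) s σ)
                     (cartesianProduct (allFin seeds) (permutations n))

  successProbability : ℚ
  successProbability = + length successes / (seeds ℕ.* n !)
    where instance
      _ : NonZero (seeds ℕ.* n !)
      _ = m*n≢0 seeds (n !) {{seedsNonZero}} {{n !≢0}}

module Submission where

-- Fix m < n.  Bob first opens the last locker, and the first m lockers are the
-- targets.  For each card c the players share a random function β c assigning
-- a target to every card; Bob, looking for s and seeing c, opens target β c s.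
-- Call c good if β c sends the card in each target to that target.  Alice puts
-- a good c into the last locker; Bob then finds every s lying in a target (and
-- c itself at once).  For each permutation a row is good with probability
-- m ^ (- m), independently over the n rows, so a good row exists with
-- probability at least n / (n + m ^ m), and s lies in a target with
-- probability m / n: the success probability is at least m / (n + m ^ m).
-- For K = ⌊log n⌋, J = ⌊log K⌋ and m = ⌊(K - J) / (J + 1)⌋ this is
-- (1 - O(1 / J)) log n / (n log log n).

open import Defs

-- Counting the successes of a uniformly random table.

module Counting where

  open import Data.Nat hiding (_≟_; _/_)
  open import Data.Nat.Properties hiding (_≟_; <⇒≢)
  open import Data.Nat.ListAction using (sum)
  open import Data.Nat.ListAction.Properties using (sum-++)
  open import Data.Nat.Tactic.RingSolver using (solve-∀)
  open import Data.Bool using (true; false; if_then_else_)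
  open import Data.Fin using (Fin; zero; suc; toℕ; fromℕ; inject≤; punchOut)
  open import Data.Fin.Properties
    using (_≟_; any?; all?; toℕ-fromℕ; toℕ-inject≤; toℕ<n; inject≤-injective; pigeonhole
          ; punchOut-injective; <⇒≢)
  open import Data.List as List
    using (List; []; _∷_; [_]; _++_; length; map; filter; allFin; cartesianProduct
          ; cartesianProductWith)
  open import Data.List.Properties
    using (map-++; map-∘; map-tabulate; tabulate-lookup; length-tabulate; length-++; length-map)
  open import Data.List.Membership.Propositional using (_∈_; _∉_)
  open import Data.List.Relation.Unary.Any using (here; there)
  open import Data.Maybe using (Maybe; just; nothing)
  open import Data.Maybe.Properties using (just-injective)
  open import Data.Vec using (Vec; []; _∷_; lookup; _[_]≔_)
  open import Data.Vec.Properties using (lookup∘update; lookup∘update′)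
  open import Data.Vec.Relation.Unary.All as All using (All; []; _∷_)
  open import Data.Vec.Relation.Unary.AllPairs using ([]; _∷_)
  open import Data.Vec.Relation.Unary.Unique.Propositional using (Unique)
  open import Data.Vec.Relation.Unary.Unique.Propositional.Properties using (lookup-injective)
  open import Data.Product using (∃; Σ-syntax; _×_; _,_)
  open import Data.Sum using (inj₁; inj₂)
  open import Function using (_∘_; id)
  open import Level using (Level)
  open import Relation.Nullary using (Dec; yes; no; does; ¬?; contradiction)
  open import Relation.Unary using (Pred; Decidable)
  open import Relation.Binary.PropositionalEquality
    using (_≡_; _≢_; refl; sym; trans; cong; cong₂; subst)

  -- Sums over lists

  private variable
    a p : Level
    A B D : Set a
    P : Set p

  ∑ : List A → (A → ℕ) → ℕ
  ∑ xs f = sum (map f xs)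

  -- The Iverson bracket: lengths of filtered lists become sums, whose order can be interchanged.
  ⟦_⟧ : Dec P → ℕ
  ⟦ d ⟧ = if does d then 1 else 0

  ≤-⟦⟧ : (d : Dec P) → P → 1 ≤ ⟦ d ⟧
  ≤-⟦⟧ (yes _) _  = ≤-refl
  ≤-⟦⟧ (no ¬p) p′ = contradiction p′ ¬p

  ⟦⟧*-≤ : (d : Dec P) {b c : ℕ} → (P → b ≤ c) → ⟦ d ⟧ * b ≤ c
  ⟦⟧*-≤ (yes p′) b≤c = ≤-trans (≤-reflexive (*-identityˡ _)) (b≤c p′)
  ⟦⟧*-≤ (no _)   _   = z≤n

  ∑-cong : ∀ (xs : List A) {f g} → (∀ x → f x ≡ g x) → ∑ xs f ≡ ∑ xs g
  ∑-cong []       f≡g = refl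
  ∑-cong (x ∷ xs) f≡g = cong₂ _+_ (f≡g x) (∑-cong xs f≡g)

  ∑-mono : ∀ (xs : List A) {f g} → (∀ x → f x ≤ g x) → ∑ xs f ≤ ∑ xs g
  ∑-mono []       f≤g = z≤n
  ∑-mono (x ∷ xs) f≤g = +-mono-≤ (f≤g x) (∑-mono xs f≤g)

  ∑-const : ∀ (xs : List A) c → ∑ xs (λ _ → c) ≡ length xs * c
  ∑-const []       c = refl
  ∑-const (x ∷ xs) c = cong (c +_) (∑-const xs c)

  ∑-distrib-+ : ∀ (xs : List A) f g → ∑ xs (λ x → f x + g x) ≡ ∑ xs f + ∑ xs g
  ∑-distrib-+ []       f g = refl
  ∑-distrib-+ (x ∷ xs) f g = trans (cong (f x + g x +_) (∑-distrib-+ xs f g))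
                                   (interchange (f x) (g x) _ _)
    where
    interchange : ∀ u v w z → u + v + (w + z) ≡ u + w + (v + z)
    interchange = solve-∀

  ∑-*ʳ : ∀ (xs : List A) f c → ∑ xs (λ x → f x * c) ≡ ∑ xs f * c
  ∑-*ʳ []       f c = refl
  ∑-*ʳ (x ∷ xs) f c = trans (cong (f x * c +_) (∑-*ʳ xs f c)) (sym (*-distribʳ-+ c (f x) _))

  ∑-swap : ∀ (xs : List A) (ys : List B) (f : A → B → ℕ) →
           ∑ xs (λ x → ∑ ys (f x)) ≡ ∑ ys (λ y → ∑ xs (λ x → f x y))
  ∑-swap []       ys f = sym (trans (∑-const ys 0) (*-zeroʳ (length ys)))
  ∑-swap (x ∷ xs) ys f = trans (cong (∑ ys (f x) +_) (∑-swap xs ys f)) (sym (∑-distrib-+ ys _ _))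

  ∑-++ : ∀ (xs ys : List A) f → ∑ (xs ++ ys) f ≡ ∑ xs f + ∑ ys f
  ∑-++ xs ys f = trans (cong sum (map-++ f xs ys)) (sum-++ (map f xs) _)

  ∑-cartesianProductWith : ∀ (g : A → B → D) xs ys f →
    ∑ (cartesianProductWith g xs ys) f ≡ ∑ xs (λ x → ∑ ys (λ y → f (g x y)))
  ∑-cartesianProductWith g []       ys f = refl
  ∑-cartesianProductWith g (x ∷ xs) ys f =
    trans (∑-++ (map (g x) ys) _ f)
          (cong₂ _+_ (cong sum (sym (map-∘ ys))) (∑-cartesianProductWith g xs ys f))

  length-filter-∑ : ∀ {P : Pred A p} (P? : Decidable P) xs →
                    length (filter P? xs) ≡ ∑ xs (λ x → ⟦ P? x ⟧)
  length-filter-∑ P? []       = refl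
  length-filter-∑ P? (x ∷ xs) with does (P? x)
  ... | true  = cong suc (length-filter-∑ P? xs)
  ... | false = length-filter-∑ P? xs

  ∑-filter : ∀ {P : Pred A p} (P? : Decidable P) xs f →
             ∑ (filter P? xs) f ≡ ∑ xs (λ x → ⟦ P? x ⟧ * f x)
  ∑-filter P? []       f = refl
  ∑-filter P? (x ∷ xs) f with does (P? x)
  ... | true  = cong₂ _+_ (sym (*-identityˡ (f x))) (∑-filter P? xs f)
  ... | false = ∑-filter P? xs f

  ∑-lookup : ∀ (xs : List A) f → ∑ (allFin (length xs)) (λ k → f (List.lookup xs k)) ≡ ∑ xs f
  ∑-lookup xs f = cong sum (trans (map-tabulate id _) (trans (sym (map-tabulate (List.lookup xs) f))
                                                             (cong (map f) (tabulate-lookup xs))))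

  ∑-allFin-suc : ∀ n f → ∑ (allFin (suc n)) f ≡ f zero + ∑ (allFin n) (f ∘ suc)
  ∑-allFin-suc n f = cong (λ xs → f zero + sum xs) (trans (map-tabulate suc f) (sym (map-tabulate id (f ∘ suc))))

  ∑-pick : ∀ n (y : Fin n) (f : Fin n → ℕ) → ∑ (allFin n) (λ x → ⟦ x ≟ y ⟧ * f x) ≡ f y
  ∑-pick (suc n) zero f = trans (∑-allFin-suc n _) (trans (cong₂ _+_ (*-identityˡ (f zero))
    (trans (∑-const (allFin n) 0) (*-zeroʳ (length (allFin n))))) (+-identityʳ _))
  ∑-pick (suc n) (suc y) f = trans (∑-allFin-suc n (λ x → ⟦ x ≟ suc y ⟧ * f x)) (∑-pick n y (f ∘ suc))

  ∑-⟦≟⟧ : ∀ n (y : Fin n) → ∑ (allFin n) (λ x → ⟦ x ≟ y ⟧) ≡ 1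
  ∑-⟦≟⟧ n y = trans (∑-cong (allFin n) (λ x → sym (*-identityʳ _))) (∑-pick n y (λ _ → 1))

  ≤-∑ : ∀ n (y : Fin n) (f : Fin n → ℕ) → f y ≤ ∑ (allFin n) f
  ≤-∑ n y f = ≤-trans (≤-reflexive (sym (∑-pick n y f))) (∑-mono (allFin n) λ x → ⟦⟧*-≤ (x ≟ y) λ _ → ≤-refl)

  ∑-allFin-const : ∀ n c → ∑ (allFin n) (λ _ → c) ≡ n * c
  ∑-allFin-const n c = trans (∑-const (allFin n) c) (cong (_* c) (length-tabulate {n = n} id))

  -- Counting permutations

  module _ {n : ℕ} where

    open import Data.List.Membership.DecPropositional (_≟_ {n}) using (_∈?_; _∉?_)

    -- Double counting: every `x` is fresh or occurs in `L`, and the occurrences, summed over all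
    -- `x`, number `length L`.
    fresh-count : ∀ (L : List (Fin n)) c → length L + c ≡ n → c ≤ ∑ (allFin n) (λ x → ⟦ x ∉? L ⟧)
    fresh-count L c |L|+c≡n = +-cancelˡ-≤ (length L) c fresh (begin
      length L + c
        ≡⟨ |L|+c≡n ⟩
      n
        ≡⟨ trans (∑-allFin-const n 1) (*-identityʳ n) ⟨
      ∑ (allFin n) (λ x → 1)
        ≤⟨ ∑-mono (allFin n) (λ x → occurs-or-fresh x L) ⟩
      ∑ (allFin n) (λ x → ∑ L (λ y → ⟦ x ≟ y ⟧) + ⟦ x ∉? L ⟧)
        ≡⟨ ∑-distrib-+ (allFin n) _ _ ⟩
      ∑ (allFin n) (λ x → ∑ L (λ y → ⟦ x ≟ y ⟧)) + fresh
        ≡⟨ cong (_+ fresh) (∑-swap (allFin n) L (λ x y → ⟦ x ≟ y ⟧)) ⟩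
      ∑ L (λ y → ∑ (allFin n) (λ x → ⟦ x ≟ y ⟧)) + fresh
        ≡⟨ cong (_+ fresh) (trans (∑-cong L (∑-⟦≟⟧ n)) (∑-const L 1)) ⟩
      length L * 1 + fresh
        ≡⟨ cong (_+ fresh) (*-identityʳ (length L)) ⟩
      length L + fresh ∎)
      where
      open ≤-Reasoning
      fresh = ∑ (allFin n) (λ x → ⟦ x ∉? L ⟧)

      occurs : ∀ x L → x ∈ L → 1 ≤ ∑ L (λ y → ⟦ x ≟ y ⟧)
      occurs x (y ∷ L) (here x≡y)  = ≤-trans (≤-⟦⟧ (x ≟ y) x≡y) (m≤m+n _ _)
      occurs x (y ∷ L) (there x∈L) = ≤-trans (occurs x L x∈L) (m≤n+m _ _)

      occurs-or-fresh : ∀ x L → 1 ≤ ∑ L (λ y → ⟦ x ≟ y ⟧) + ⟦ x ∉? L ⟧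
      occurs-or-fresh x L with x ∈? L
      ... | yes x∈L = ≤-trans (occurs x L x∈L) (m≤m+n _ _)
      ... | no x∉L  = m≤n+m _ _

    ∑-fresh : ∀ L c b f → length L + c ≡ n → (∀ x → x ∉ L → b ≤ f x) → c * b ≤ ∑ (allFin n) f
    ∑-fresh L c b f |L|+c≡n b≤f = begin
      c * b                                ≤⟨ *-monoˡ-≤ b (fresh-count L c |L|+c≡n) ⟩
      ∑ (allFin n) (λ x → ⟦ x ∉? L ⟧) * b  ≡⟨ ∑-*ʳ (allFin n) _ b ⟨
      ∑ (allFin n) (λ x → ⟦ x ∉? L ⟧ * b)  ≤⟨ ∑-mono (allFin n) (λ x → ⟦⟧*-≤ (x ∉? L) (b≤f x)) ⟩
      ∑ (allFin n) f                       ∎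
      where open ≤-Reasoning

    ∑-allVecs-suc : ∀ k (f : Vec (Fin n) (suc k) → ℕ) →
      ∑ (allVecs n (suc k)) f ≡ ∑ (allFin n) (λ x → ∑ (allVecs n k) (λ v → f (x ∷ v)))
    ∑-allVecs-suc k f = ∑-cartesianProductWith _∷_ (allFin n) (allVecs n k) f

    private
      extend : ∀ {k L x} {v : Vec (Fin n) k} → x ∉ L → Unique v → All (_∉ x ∷ L) v →
               Unique (x ∷ v) × All (_∉ L) (x ∷ v)
      extend x∉L v! v# = (All.map (λ y∉ x≡y → y∉ (here (sym x≡y))) v# ∷ v!) ,
                         (x∉L ∷ All.map (λ y∉ y∈L → y∉ (there y∈L)) v#)

    -- L lists the values already used, so that the induction can run along the
    -- vector; it may have repetitions, which only help.

    ∑-arrangements : ∀ k L b f → length L + k ≡ n →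
      (∀ v → Unique v → All (_∉ L) v → b ≤ f v) → b * k ! ≤ ∑ (allVecs n k) f
    ∑-arrangements zero L b f _ b≤f =
      ≤-trans (≤-reflexive (*-identityʳ b)) (≤-trans (b≤f [] [] []) (m≤m+n _ 0))
    ∑-arrangements (suc k) L b f |L|+k≡n b≤f = begin
      b * (suc k * k !)  ≡⟨ rearrange b (suc k) (k !) ⟩
      suc k * (b * k !)  ≤⟨ ∑-fresh L (suc k) _ _ |L|+k≡n (λ x x∉L →
                              ∑-arrangements k (x ∷ L) b _ (trans (sym (+-suc _ k)) |L|+k≡n)
                                λ v v! v# → let xv! , xv# = extend x∉L v! v# in b≤f (x ∷ v) xv! xv#) ⟩
      ∑ (allFin n) _     ≡⟨ ∑-allVecs-suc k f ⟨
      ∑ (allVecs n (suc k)) f ∎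
      where
      open ≤-Reasoning
      rearrange : ∀ u v w → u * (v * w) ≡ v * (u * w)
      rearrange = solve-∀

    -- Split by the first entry. If it is `s`, the rest can be arranged in `k !` ways. Otherwise it
    -- is one of `k` other fresh values, and `s` has to come within the first `m - 1` of the
    -- remaining places; `late` handles this by recursion.
    ∑-arrangements-early : ∀ k m (m≤1+k : m ≤ suc k) L s b f → length L + suc k ≡ n → s ∉ L →
      (∀ v → Unique v → All (_∉ L) v → ∀ (i : Fin m) → lookup v (inject≤ i m≤1+k) ≡ s → b ≤ f v) →
      m * (b * k !) ≤ ∑ (allVecs n (suc k)) f
    ∑-arrangements-early k zero _ L s b f _ _ _ = z≤n
    ∑-arrangements-early k (suc m) m≤k L s b f |L|+k≡n s∉L b≤f = begin
      b * k ! + m * (b * k !)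
        ≤⟨ +-monoʳ-≤ _ (late k m m≤k |sL|+k≡n b≤f) ⟩
      b * k ! + ∑ (allFin n) (λ x → ⟦ ¬? (x ≟ s) ⟧ * T x)
        ≤⟨ +-monoˡ-≤ _ (∑-arrangements k (s ∷ L) b (λ v → f (s ∷ v)) |sL|+k≡n
             λ v v! v# → let sv! , sv# = extend s∉L v! v# in b≤f (s ∷ v) sv! sv# zero refl) ⟩
      T s + ∑ (allFin n) (λ x → ⟦ ¬? (x ≟ s) ⟧ * T x)
        ≡⟨ cong (_+ ∑ (allFin n) (λ x → ⟦ ¬? (x ≟ s) ⟧ * T x)) (∑-pick n s T) ⟨
      ∑ (allFin n) (λ x → ⟦ x ≟ s ⟧ * T x) + ∑ (allFin n) (λ x → ⟦ ¬? (x ≟ s) ⟧ * T x)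
        ≡⟨ ∑-distrib-+ (allFin n) _ _ ⟨
      ∑ (allFin n) (λ x → ⟦ x ≟ s ⟧ * T x + ⟦ ¬? (x ≟ s) ⟧ * T x)
        ≤⟨ ∑-mono (allFin n) dichotomy ⟩
      ∑ (allFin n) T
        ≡⟨ ∑-allVecs-suc k f ⟨
      ∑ (allVecs n (suc k)) f ∎
      where
      open ≤-Reasoning
      T : Fin n → ℕ
      T x = ∑ (allVecs n k) (λ v → f (x ∷ v))

      |sL|+k≡n : length (s ∷ L) + k ≡ n
      |sL|+k≡n = trans (sym (+-suc _ k)) |L|+k≡n

      dichotomy : ∀ x → ⟦ x ≟ s ⟧ * T x + ⟦ ¬? (x ≟ s) ⟧ * T x ≤ T x
      dichotomy x with does (x ≟ s)
      ... | true  = ≤-reflexive (trans (+-identityʳ _) (+-identityʳ _))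
      ... | false = ≤-reflexive (+-identityʳ _)

      late : ∀ k m (m≤k : suc m ≤ suc k) {f : Vec (Fin n) (suc k) → ℕ} → length (s ∷ L) + k ≡ n →
        (∀ v → Unique v → All (_∉ L) v → ∀ (i : Fin (suc m)) → lookup v (inject≤ i m≤k) ≡ s → b ≤ f v) →
        m * (b * k !) ≤ ∑ (allFin n) (λ x → ⟦ ¬? (x ≟ s) ⟧ * ∑ (allVecs n k) (λ v → f (x ∷ v)))
      late zero    zero    m≤k _ _ = z≤n
      late zero    (suc m) (s≤s ()) _ _
      late (suc k) m (s≤s m≤k) {f} |sL|+k≡n b≤f = begin
        m * (b * (suc k * k !)) ≡⟨ rearrange m b (suc k) (k !) ⟩
        suc k * (m * (b * k !)) ≤⟨ ∑-fresh (s ∷ L) (suc k) _ _ |sL|+k≡n (λ x x∉sL →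
            ≤-trans (∑-arrangements-early k m m≤k (x ∷ L) s b _ |sL|+k≡n
                (λ { (here s≡x) → x∉sL (here (sym s≡x)) ; (there s∈L) → s∉L s∈L })
                λ v v! v# i vᵢ≡s → let xv! , xv# = extend (λ x∈L → x∉sL (there x∈L)) v! v# in b≤f (x ∷ v) xv! xv# (suc i) vᵢ≡s)
              (≤-trans (≤-reflexive (sym (*-identityˡ _))) (*-monoˡ-≤ _ (≤-⟦⟧ (¬? (x ≟ s)) λ x≡s → x∉sL (here x≡s))))) ⟩
        ∑ (allFin n) _ ∎
        where
        rearrange : ∀ t u v w → t * (u * (v * w)) ≡ v * (t * (u * w))
        rearrange = solve-∀

  -- Products of lists, and the tables with a good row

  vecs : List A → ∀ k → List (Vec A k)
  vecs xs zero    = [ [] ]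
  vecs xs (suc k) = cartesianProductWith _∷_ xs (vecs xs k)

  length-cartesianProductWith : ∀ (g : A → B → D) xs ys →
    length (cartesianProductWith g xs ys) ≡ length xs * length ys
  length-cartesianProductWith g []       ys = refl
  length-cartesianProductWith g (x ∷ xs) ys = trans (length-++ (map (g x) ys))
    (cong₂ _+_ (length-map (g x) ys) (length-cartesianProductWith g xs ys))

  length-allVecs : ∀ m k → length (allVecs m k) ≡ m ^ k
  length-allVecs m zero    = refl
  length-allVecs m (suc k) = trans (length-cartesianProductWith _∷_ (allFin m) (allVecs m k))
                                   (cong₂ _*_ (length-tabulate {n = m} id) (length-allVecs m k))

  length-vecs : ∀ (xs : List A) k → length (vecs xs k) ≡ length xs ^ k
  length-vecs xs zero    = refl
  length-vecs xs (suc k) = trans (length-cartesianProductWith _∷_ xs (vecs xs k))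
                                 (cong (length xs *_) (length-vecs xs k))

  -- This is (1 - 1/M) ^ N ≤ M / (N + M), multiplied out.

  ∑-exists : ∀ {Good : Pred A p} (good? : Decidable Good) xs M → length xs ≤ ∑ xs (λ x → ⟦ good? x ⟧) * M →
    ∀ N f → (∀ t → (∃ λ c → Good (lookup t c)) → 1 ≤ f t) →
    N * length xs ^ N ≤ ∑ (vecs xs N) f * (N + M)
  ∑-exists good? xs M |xs|≤ zero    f 1≤f = z≤n
  ∑-exists good? xs M |xs|≤ (suc N) f 1≤f = begin
    suc N * (ℓ * ℓ^N)
      ≡⟨ expand N ℓ ℓ^N ⟩
    ℓ * (N * ℓ^N) + ℓ * ℓ^N
      ≤⟨ +-monoʳ-≤ (ℓ * (N * ℓ^N)) (*-monoˡ-≤ ℓ^N |xs|≤) ⟩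
    ℓ * (N * ℓ^N) + g * M * ℓ^N
      ≡⟨ cong (ℓ * (N * ℓ^N) +_) (*-assoc g M ℓ^N) ⟩
    ℓ * (N * ℓ^N) + g * (M * ℓ^N)
      ≡⟨ cong₂ _+_ (∑-const xs _) (∑-*ʳ xs _ _) ⟨
    ∑ xs (λ _ → N * ℓ^N) + ∑ xs (λ x → ⟦ good? x ⟧ * (M * ℓ^N))
      ≡⟨ ∑-distrib-+ xs _ _ ⟨
    ∑ xs (λ x → N * ℓ^N + ⟦ good? x ⟧ * (M * ℓ^N))
      ≤⟨ ∑-mono xs row ⟩
    ∑ xs (λ x → T x * (N + M))
      ≡⟨ ∑-*ʳ xs T (N + M) ⟩
    ∑ xs T * (N + M)
      ≡⟨ cong (_* (N + M)) (∑-cartesianProductWith _∷_ xs (vecs xs N) f) ⟨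
    ∑ (vecs xs (suc N)) f * (N + M)
      ≤⟨ *-monoʳ-≤ (∑ (vecs xs (suc N)) f) (n≤1+n (N + M)) ⟩
    ∑ (vecs xs (suc N)) f * (suc N + M) ∎
    where
    open ≤-Reasoning
    ℓ = length xs
    ℓ^N = ℓ ^ N
    g = ∑ xs (λ x → ⟦ good? x ⟧)
    T = λ x → ∑ (vecs xs N) (λ t → f (x ∷ t))

    expand : ∀ u v w → (1 + u) * (v * w) ≡ v * (u * w) + v * w
    expand = solve-∀

    factor : ∀ u v w → u * w + (v * w + 0) ≡ w * (u + v)
    factor = solve-∀

    |tables| : ℓ^N ≡ ∑ (vecs xs N) (λ _ → 1)
    |tables| = sym (trans (∑-const (vecs xs N) 1) (trans (*-identityʳ _) (length-vecs xs N)))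

    row : ∀ x → N * ℓ^N + ⟦ good? x ⟧ * (M * ℓ^N) ≤ T x * (N + M)
    row x with good? x
    -- A good first row makes all `ℓ^N` continuations count, which pays for both summands.
    ... | yes gx = ≤-trans (≤-reflexive (factor N M ℓ^N)) (*-monoˡ-≤ (N + M)
                     (≤-trans (≤-reflexive |tables|) (∑-mono (vecs xs N) λ t → 1≤f (x ∷ t) (zero , gx))))
    ... | no _   = ≤-trans (≤-reflexive (+-identityʳ _))
                     (∑-exists good? xs M |xs|≤ N _ λ t → λ (c , gc) → 1≤f (x ∷ t) (suc c , gc))

  weight : Maybe A → ℕ
  weight nothing  = 0
  weight (just _) = 1

  -- Coordinate by coordinate: a prescribed value costs a factor `m`, a free one nothing. The cost
  -- multiplies the count on the right, so that no exponent is subtracted.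
  ∑-prescribed : ∀ m n (C : Fin n → Maybe (Fin m)) f →
    (∀ β → (∀ x y → C x ≡ just y → lookup β x ≡ y) → 1 ≤ f β) →
    m ^ n ≤ ∑ (allVecs m n) f * m ^ ∑ (allFin n) (weight ∘ C)
  ∑-prescribed m zero C f 1≤f = ≤-trans (1≤f [] λ ()) (≤-trans (m≤m+n (f []) 0) (≤-reflexive (sym (*-identityʳ _))))
  ∑-prescribed m (suc n) C f 1≤f = begin
    m * m ^ n
      ≤⟨ head (C zero) refl ⟩
    ∑ (allFin m) T * (m ^ weight (C zero) * m ^ w)
      ≡⟨ cong₂ _*_ (∑-allVecs-suc n f) (trans (cong (m ^_) (∑-allFin-suc n (weight ∘ C))) (^-distribˡ-+-* m (weight (C zero)) w)) ⟨
    ∑ (allVecs m (suc n)) f * m ^ ∑ (allFin (suc n)) (weight ∘ C) ∎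
    where
    open ≤-Reasoning
    w = ∑ (allFin n) (weight ∘ C ∘ suc)
    T = λ y → ∑ (allVecs m n) (λ β → f (y ∷ β))

    rest : ∀ y → (∀ y′ → C zero ≡ just y′ → y ≡ y′) → m ^ n ≤ T y * m ^ w
    rest y fits = ∑-prescribed m n (C ∘ suc) _ λ β fits′ →
      1≤f (y ∷ β) λ { zero → fits ; (suc x) → fits′ x }

    head : ∀ c → C zero ≡ c → m * m ^ n ≤ ∑ (allFin m) T * (m ^ weight c * m ^ w)
    head nothing C₀≡ = begin
      m * m ^ n
        ≡⟨ ∑-allFin-const m _ ⟨
      ∑ (allFin m) (λ y → m ^ n)
        ≤⟨ ∑-mono (allFin m) (λ y → rest y λ y′ eq → contradiction (trans (sym C₀≡) eq) λ ()) ⟩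
      ∑ (allFin m) (λ y → T y * m ^ w)
        ≡⟨ ∑-*ʳ (allFin m) T _ ⟩
      ∑ (allFin m) T * m ^ w
        ≡⟨ cong (∑ (allFin m) T *_) (*-identityˡ (m ^ w)) ⟨
      ∑ (allFin m) T * (1 * m ^ w) ∎
    head (just y) C₀≡ = begin
      m * m ^ n
        ≤⟨ *-monoʳ-≤ m (rest y λ { y′ eq → just-injective (trans (sym C₀≡) eq) }) ⟩
      m * (T y * m ^ w)
        ≤⟨ *-monoʳ-≤ m (*-monoˡ-≤ (m ^ w) (≤-∑ m y T)) ⟩
      m * (∑ (allFin m) T * m ^ w)
        ≡⟨ rearrange m (∑ (allFin m) T) (m ^ w) ⟩
      ∑ (allFin m) T * (m ^ 1 * m ^ w) ∎
      where
      rearrange : ∀ u v w → u * (v * w) ≡ v * ((u * 1) * w)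
      rearrange = solve-∀

  -- If `c` were missed, punching it out would map `suc n` lockers into `n` values, and the
  -- pigeonhole principle would give a repeated card.
  unique⇒surjective : ∀ {n} (σ : Contents n) → Unique σ → ∀ c → ∃ λ ℓ → lookup σ ℓ ≡ c
  unique⇒surjective {suc n} σ σ! c with any? (λ ℓ → lookup σ ℓ ≟ c)
  ... | yes ∃ℓ = ∃ℓ
  ... | no ∄ℓ  =
    let c≢ = λ ℓ c≡σℓ → ∄ℓ (ℓ , sym c≡σℓ)
        i , j , i<j , eq = pigeonhole (n<1+n n) (λ ℓ → punchOut (c≢ ℓ))
    in contradiction (lookup-injective σ! i j (punchOut-injective (c≢ i) (c≢ j) eq)) (<⇒≢ i<j)

  -- The strategy

  module _ {n′ m : ℕ} (m≤n′ : m ≤ n′) where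

    private
      n : ℕ
      n = suc n′

      m≤n : m ≤ n
      m≤n = m≤n⇒m≤1+n m≤n′

    Guess Table : Set
    Guess = Vec (Fin m) n
    Table = Vec Guess n

    signal : Fin n
    signal = fromℕ n′

    target : Fin m → Fin n
    target i = inject≤ i m≤n

    target≢signal : ∀ i → target i ≢ signal
    target≢signal i eq = <⇒≱ (toℕ<n i) (≤-trans m≤n′ (≤-reflexive
      (trans (sym (toℕ-fromℕ n′)) (trans (cong toℕ (sym eq)) (toℕ-inject≤ i m≤n)))))

    Good : Contents n → Guess → Set
    Good σ β = ∀ i → lookup β (lookup σ (target i)) ≡ i

    good? : ∀ σ β → Dec (Good σ β)
    good? σ β = all? (λ i → lookup β (lookup σ (target i)) ≟ i)

    locate : Contents n → Fin n → Fin n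
    locate σ c with any? (λ ℓ → lookup σ ℓ ≟ c)
    ... | yes (ℓ , _) = ℓ
    ... | no _        = signal

    locate-correct : ∀ σ → Unique σ → ∀ c → lookup σ (locate σ c) ≡ c
    locate-correct σ σ! c with any? (λ ℓ → lookup σ ℓ ≟ c)
    ... | yes (_ , σℓ≡c) = σℓ≡c
    ... | no ∄ℓ          = contradiction (unique⇒surjective σ σ! c) ∄ℓ

    choose : Table → Contents n → Fin n
    choose t σ with any? (λ c → good? σ (lookup t c))
    ... | yes (c , _) = c
    -- An arbitrary default: no success is claimed for permutations without a good row.
    ... | no _        = signal

    choose-good : ∀ t σ → (∃ λ c → Good σ (lookup t c)) → Good σ (lookup t (choose t σ))
    choose-good t σ ∃c with any? (λ c → good? σ (lookup t c))
    ... | yes (_ , gc) = gc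
    ... | no ∄c        = contradiction ∃c ∄c

    strategy : Table → Strategy n
    strategy t .alice σ    = signal , locate σ (choose t σ)
    strategy t .first s    = signal
    strategy t .second s c = target (lookup (lookup t c) s)

    lookup-swap-first : ∀ (i j : Fin n) σ → lookup (swap (i , j) σ) i ≡ lookup σ j
    lookup-swap-first i j σ with i ≟ j
    ... | yes refl = lookup∘update i (σ [ i ]≔ lookup σ i) (lookup σ i)
    ... | no i≢j   = trans (lookup∘update′ i≢j (σ [ i ]≔ lookup σ j) _) (lookup∘update i σ _)

    lookup-swap-other : ∀ (i j k : Fin n) σ → k ≢ i → k ≢ j → lookup (swap (i , j) σ) k ≡ lookup σ k
    lookup-swap-other i j k σ k≢i k≢j =
      trans (lookup∘update′ k≢j (σ [ i ]≔ lookup σ j) _) (lookup∘update′ k≢i σ _)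

    -- Since row `c` is good, it sends `s` to `i`, so Bob's second locker is `target i`. The swap
    -- disturbs that locker only if it held `c`; then `c ≡ s`, and `s` is already seen in the first
    -- locker.
    strategy-finds : ∀ t s σ → Unique σ → (∃ λ c → Good σ (lookup t c)) →
                     ∀ i → lookup σ (target i) ≡ s → Finds (strategy t) s σ
    strategy-finds t s σ σ! ∃c i σi≡s = finds
      where
      c    = choose t σ
      good = choose-good t σ ∃c
      τ    = swap (signal , locate σ c) σ

      seen : lookup τ signal ≡ c
      seen = trans (lookup-swap-first signal (locate σ c) σ) (locate-correct σ σ! c)

      second≡ : second (strategy t) s (lookup τ signal) ≡ target i
      second≡ rewrite seen = cong target (trans (cong (lookup (lookup t c)) (sym σi≡s)) (good i))

      finds : Finds (strategy t) s σ
      finds with c ≟ s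
      ... | yes c≡s = inj₁ (trans seen c≡s)
      ... | no c≢s  = inj₂ (trans (cong (lookup τ) second≡)
        (trans (lookup-swap-other signal (locate σ c) (target i) σ (target≢signal i)
                 λ eq → c≢s (trans (sym (locate-correct σ σ! c)) (trans (cong (lookup σ) (sym eq)) σi≡s)))
               σi≡s))

    guesses : List Guess
    guesses = allVecs m n

    tables : List Table
    tables = vecs guesses n

    -- Being good prescribes `β` only on the cards in the targets, at most `m` of them. `C` is the
    -- partial inverse of the map from targets to their cards; it is consistent because `σ` has no
    -- repetitions.
    good-guesses : ∀ σ → Unique σ → length guesses ≤ ∑ guesses (λ β → ⟦ good? σ β ⟧) * m ^ m
    good-guesses σ σ! = begin
      length guesses
        ≡⟨ length-allVecs m n ⟩
      m ^ n
        ≤⟨ ∑-prescribed m n C _ (λ β fits → ≤-⟦⟧ (good? σ β) λ i → fits _ i (C-target i)) ⟩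
      ∑ guesses (λ β → ⟦ good? σ β ⟧) * m ^ ∑ (allFin n) (weight ∘ C)
        ≤⟨ *-monoʳ-≤ (∑ guesses (λ β → ⟦ good? σ β ⟧)) (pow-mono m (C-weight)) ⟩
      ∑ guesses (λ β → ⟦ good? σ β ⟧) * m ^ m ∎
      where
      open ≤-Reasoning
      C : Fin n → Maybe (Fin m)
      C x with any? (λ i → x ≟ lookup σ (target i))
      ... | yes (i , _) = just i
      ... | no _        = nothing

      C-target : ∀ i → C (lookup σ (target i)) ≡ just i
      C-target i with any? (λ j → lookup σ (target i) ≟ lookup σ (target j))
      ... | yes (j , eq) = cong just (sym (inject≤-injective m≤n m≤n i j (lookup-injective σ! _ _ eq)))
      ... | no ∄j        = contradiction (i , refl) ∄j

      weight≤ : ∀ x → weight (C x) ≤ ∑ (allFin m) (λ i → ⟦ x ≟ lookup σ (target i) ⟧)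
      weight≤ x with any? (λ i → x ≟ lookup σ (target i))
      ... | yes (i , eq) = ≤-trans (≤-⟦⟧ (x ≟ lookup σ (target i)) eq) (≤-∑ m i (λ i → ⟦ x ≟ lookup σ (target i) ⟧))
      ... | no _         = z≤n

      C-weight : ∑ (allFin n) (weight ∘ C) ≤ m
      C-weight = begin
        ∑ (allFin n) (weight ∘ C)
          ≤⟨ ∑-mono (allFin n) weight≤ ⟩
        ∑ (allFin n) (λ x → ∑ (allFin m) (λ i → ⟦ x ≟ lookup σ (target i) ⟧))
          ≡⟨ ∑-swap (allFin n) (allFin m) (λ x i → ⟦ x ≟ lookup σ (target i) ⟧) ⟩
        ∑ (allFin m) (λ i → ∑ (allFin n) (λ x → ⟦ x ≟ lookup σ (target i) ⟧))
          ≡⟨ ∑-cong (allFin m) (λ i → ∑-⟦≟⟧ n (lookup σ (target i))) ⟩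
        ∑ (allFin m) (λ i → 1)
          ≡⟨ trans (∑-allFin-const m 1) (*-identityʳ m) ⟩
        m ∎

      pow-mono : ∀ m {j} → j ≤ m → m ^ j ≤ m ^ m
      -- Base 0 is separate: `0 ^ 0` exceeds the other powers of 0, but here the exponent is itself
      -- at most 0.
      pow-mono zero    z≤n = ≤-refl
      pow-mono (suc m) j≤m = ^-monoʳ-≤ (suc m) j≤m

    -- The permutation is fixed and only the table is random: its `n` rows are independent, each
    -- good with probability at least `1 / m ^ m`.
    good-tables : ∀ σ → Unique σ → ∀ s i → lookup σ (target i) ≡ s →
      n * length tables ≤ ∑ tables (λ t → ⟦ finds? (strategy t) s σ ⟧) * (n + m ^ m)
    good-tables σ σ! s i σi≡s = ≤-trans
      (≤-reflexive (cong (n *_) (length-vecs guesses n)))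
      (∑-exists (good? σ) guesses (m ^ m) (good-guesses σ σ!) n _
        λ t ∃c → ≤-⟦⟧ (finds? (strategy t) s σ) (strategy-finds t s σ σ! ∃c i σi≡s))

    -- At least `m * n′ !` permutations put `s` into a target, and each contributes the bound of
    -- `good-tables`, whose factor `n` turns `n′ !` into `n !`.
    many-successes : ∀ s → m * (length tables * n !) ≤
      ∑ (permutations n) (λ σ → ∑ tables (λ t → ⟦ finds? (strategy t) s σ ⟧)) * (n + m ^ m)
    many-successes s = begin
      m * (length tables * (n * n′ !)) ≡⟨ rearrange m (length tables) n (n′ !) ⟩
      m * (n * length tables * n′ !) ≤⟨ ∑-arrangements-early n′ m m≤n [] s (n * length tables) _ refl (λ ()) (λ σ σ! _ i σi≡s →
          ≤-trans (good-tables σ σ! s i σi≡s) (≤-trans (≤-reflexive (sym (*-identityˡ _))) (*-monoˡ-≤ _ (≤-⟦⟧ (unique? σ) σ!)))) ⟩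
      ∑ (allVecs n n) (λ σ → ⟦ unique? σ ⟧ * (f σ * (n + m ^ m))) ≡⟨ ∑-filter unique? (allVecs n n) _ ⟨
      ∑ (permutations n) (λ σ → f σ * (n + m ^ m)) ≡⟨ ∑-*ʳ (permutations n) f _ ⟩
      ∑ (permutations n) f * (n + m ^ m) ∎
      where
      open ≤-Reasoning
      f : Contents n → ℕ
      f σ = ∑ tables (λ t → ⟦ finds? (strategy t) s σ ⟧)

      rearrange : ∀ u v w z → u * (v * (w * z)) ≡ u * (w * v * z)
      rearrange = solve-∀

    -- The shared randomness is the table; a nonzero `m` makes the list of tables nonempty.
    randomized : .{{NonZero m}} → RandomizedStrategy n
    randomized .RandomizedStrategy.seeds        = length tables
    randomized .RandomizedStrategy.seedsNonZero =
      subst NonZero (sym (trans (length-vecs guesses n) (cong (_^ n) (length-allVecs m n)))) (m^n≢0 (m ^ n) n {{m^n≢0 m n}})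
    randomized .RandomizedStrategy.play k       = strategy (List.lookup tables k)

    randomized-successes : .{{_ : NonZero m}} → ∀ s →
      m * (length tables * n !) ≤ length (successes randomized s) * (n + m ^ m)
    randomized-successes s = ≤-trans (many-successes s) (≤-reflexive (cong (_* (n + m ^ m)) (sym count)))
      where
      count : length (successes randomized s) ≡ ∑ (permutations n) (λ σ → ∑ tables (λ t → ⟦ finds? (strategy t) s σ ⟧))
      count = trans (length-filter-∑ _ (cartesianProduct (allFin (length tables)) (permutations n)))
             (trans (∑-cartesianProductWith _,_ (allFin (length tables)) (permutations n) _)
             (trans (∑-lookup tables (λ t → ∑ (permutations n) (λ σ → ⟦ finds? (strategy t) s σ ⟧)))
                    (∑-swap tables (permutations n) (λ t σ → ⟦ finds? (strategy t) s σ ⟧))))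

  good-strategy : ∀ n m → m < n → 2 ≤ n → Σ[ R ∈ RandomizedStrategy n ]
    (∀ s → m * (RandomizedStrategy.seeds R * n !) ≤ length (successes R s) * (n + m ^ m))
  -- The bound is trivial for `m = 0`, but without targets there are no tables, so the strategy with
  -- one target stands in.
  good-strategy (suc n′) zero      _         (s≤s 1≤n′) = randomized 1≤n′ , λ s → z≤n
  good-strategy (suc n′) m@(suc _) (s≤s m≤n′) _         = randomized m≤n′ , randomized-successes m≤n′

-- Rational arithmetic and integer bounds on the cuts.

module Cuts where

  open import Data.Nat as ℕ using (ℕ; zero; suc; s≤s; z≤n; NonZero)
  import Data.Nat.Properties as ℕ
  open import Data.Integer as ℤ using (+_; -[1+_])
  import Data.Integer.Properties as ℤ
  open import Data.Rational
    using (ℚ; _+_; _*_; -_; _<_; _≤_; _/_; 0ℚ; 1ℚ; ½; ↥_; ↧_; ↧ₙ_; toℚᵘ; nonNegative)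
  open import Data.Rational.Properties
  import Data.Rational.Unnormalised as ℚᵘ
  import Data.Rational.Unnormalised.Properties as ℚᵘ
  open import Algebra.Definitions.RawSemiring +-*-rawSemiring using (_^_)
  open import Data.Product using (_,_)
  open import Data.Sum using (inj₁; inj₂)
  open import Relation.Nullary using (yes; no; contradiction)
  open import Relation.Binary.PropositionalEquality
    using (_≡_; refl; sym; trans; cong; cong₂; subst; subst₂)

  toℚᵘ-/ : ∀ i d .{{_ : NonZero d}} → toℚᵘ (i / d) ℚᵘ.≃ (i ℚᵘ./ d)
  toℚᵘ-/ i (suc d) = toℚᵘ-fromℚᵘ (ℚᵘ.mkℚᵘ i d)

  /-mono-≤ : ∀ a b c d .{{_ : NonZero b}} .{{_ : NonZero d}} → a ℕ.* d ℕ.≤ c ℕ.* b → + a / b ≤ + c / d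
  /-mono-≤ a b@(suc _) c d@(suc _) ad≤cb = toℚᵘ-cancel-≤
    (ℚᵘ.≤-trans (ℚᵘ.≤-reflexive (toℚᵘ-/ (+ a) b))
    (ℚᵘ.≤-trans (ℚᵘ.*≤* (subst₂ ℤ._≤_ (ℤ.pos-* a d) (ℤ.pos-* c b) (ℤ.+≤+ ad≤cb)))
                (ℚᵘ.≤-reflexive (ℚᵘ.≃-sym (toℚᵘ-/ (+ c) d)))))

  /-* : ∀ a b c d .{{_ : NonZero b}} .{{_ : NonZero d}} .{{_ : NonZero (b ℕ.* d)}} →
        (+ a / b) * (+ c / d) ≡ + (a ℕ.* c) / (b ℕ.* d)
  /-* a b@(suc _) c d@(suc _) = toℚᵘ-injective
    (ℚᵘ.≃-trans (toℚᵘ-homo-* (+ a / b) (+ c / d))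
    (ℚᵘ.≃-trans (ℚᵘ.*-cong (toℚᵘ-/ (+ a) b) (toℚᵘ-/ (+ c) d))
    (ℚᵘ.≃-trans (ℚᵘ.≃-reflexive (cong (ℚᵘ._/ (b ℕ.* d)) (sym (ℤ.pos-* a c))))
                (ℚᵘ.≃-sym (toℚᵘ-/ (+ (a ℕ.* c)) (b ℕ.* d))))))

  0≤/ : ∀ a b .{{_ : NonZero b}} → 0ℚ ≤ + a / b
  0≤/ a b = nonNegative⁻¹ (+ a / b) {{normalize-nonNeg a b}}

  -- Truncation can only enlarge the right side, so `a > b` is covered as well.
  1-/≤ : ∀ a b .{{_ : NonZero b}} → 1ℚ + (- (+ a / b)) ≤ + (b ℕ.∸ a) / b
  1-/≤ a b@(suc _) = begin
    1ℚ + (- (+ a / b))                           ≤⟨ +-monoˡ-≤ (- (+ a / b)) 1≤ ⟩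
    + (b ℕ.∸ a) / b + + a / b + (- (+ a / b))    ≡⟨ +-assoc (+ (b ℕ.∸ a) / b) (+ a / b) (- (+ a / b)) ⟩
    + (b ℕ.∸ a) / b + (+ a / b + (- (+ a / b)))  ≡⟨ cong (λ z → + (b ℕ.∸ a) / b + z) (+-inverseʳ (+ a / b)) ⟩
    + (b ℕ.∸ a) / b + 0ℚ                         ≡⟨ +-identityʳ _ ⟩
    + (b ℕ.∸ a) / b                              ∎
    where
    open ≤-Reasoning
    1≤ : 1ℚ ≤ + (b ℕ.∸ a) / b + + a / b
    1≤ = toℚᵘ-cancel-≤ (ℚᵘ.≤-trans step (ℚᵘ.≤-reflexive (ℚᵘ.≃-sym
           (ℚᵘ.≃-trans (toℚᵘ-homo-+ (+ (b ℕ.∸ a) / b) (+ a / b))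
                       (ℚᵘ.+-cong (toℚᵘ-/ (+ (b ℕ.∸ a)) b) (toℚᵘ-/ (+ a) b))))))
      where
      nat : b ℕ.* b ℕ.≤ (b ℕ.∸ a) ℕ.* b ℕ.+ a ℕ.* b
      nat = ℕ.≤-trans (ℕ.*-monoˡ-≤ b (ℕ.≤-trans (ℕ.m≤n+m∸n b a) (ℕ.≤-reflexive (ℕ.+-comm a (b ℕ.∸ a)))))
                      (ℕ.≤-reflexive (ℕ.*-distribʳ-+ b (b ℕ.∸ a) a))
      step : ℚᵘ.1ℚᵘ ℚᵘ.≤ (+ (b ℕ.∸ a) ℚᵘ./ b) ℚᵘ.+ (+ a ℚᵘ./ b)
      step = ℚᵘ.*≤* (subst₂ ℤ._≤_ (trans (ℤ.pos-* b b) (sym (ℤ.*-identityˡ _)))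
        (trans (ℤ.pos-+ ((b ℕ.∸ a) ℕ.* b) (a ℕ.* b)) (trans (cong₂ ℤ._+_ (ℤ.pos-* (b ℕ.∸ a) b) (ℤ.pos-* a b)) (sym (ℤ.*-identityʳ _))))
        (ℤ.+≤+ nat))

  infix 8 _/1
  _/1 : ℕ → ℚ
  k /1 = + k / 1

  /1-mono-≤ : ∀ {j k} → j ℕ.≤ k → j /1 ≤ k /1
  /1-mono-≤ {j} {k} j≤k = /-mono-≤ j 1 k 1 (ℕ.*-monoˡ-≤ 1 j≤k)

  /1-* : ∀ j k → (j ℕ.* k) /1 ≡ j /1 * k /1
  /1-* j k = sym (/-* j 1 k 1)

  /1-^ : ∀ j k → (j ℕ.^ k) /1 ≡ (j /1) ^ k
  /1-^ j zero    = refl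
  /1-^ j (suc k) = trans (/1-* j (j ℕ.^ k)) (cong (j /1 *_) (/1-^ j k))

  /1<⇒≤↥ : ∀ k q → k /1 < q → + k ℤ.* + (↧ₙ q) ℤ.≤ ↥ q
  /1<⇒≤↥ k q@record{} k<q = ℤ.<⇒≤ (subst (+ k ℤ.* ↧ q ℤ.<_) (ℤ.*-identityʳ (↥ q))
    (ℚᵘ.drop-*<* (ℚᵘ.<-respˡ-≃ (toℚᵘ-/ (+ k) 1) (toℚᵘ-mono-< k<q))))

  </1⇒↥≤ : ∀ k q → q < k /1 → ↥ q ℤ.≤ + k ℤ.* + (↧ₙ q)
  </1⇒↥≤ k q@record{} q<k = ℤ.<⇒≤ (subst (ℤ._< + k ℤ.* ↧ q) (ℤ.*-identityʳ (↥ q))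
    (ℚᵘ.drop-*<* (ℚᵘ.<-respʳ-≃ (toℚᵘ-/ (+ k) 1) (toℚᵘ-mono-< q<k))))

  *-mono-≤₀ : ∀ {a b c d} → 0ℚ ≤ a → 0ℚ ≤ d → a ≤ b → c ≤ d → a * c ≤ b * d
  *-mono-≤₀ {a} {b} {c} {d} 0≤a 0≤d a≤b c≤d = ≤-trans
    (*-monoˡ-≤-nonNeg a {{nonNegative 0≤a}} c≤d) (*-monoʳ-≤-nonNeg d {{nonNegative 0≤d}} a≤b)

  0≤* : ∀ {a b} → 0ℚ ≤ a → 0ℚ ≤ b → 0ℚ ≤ a * b
  0≤* {a} {b} 0≤a 0≤b = ≤-trans (≤-reflexive (sym (*-zeroʳ a))) (*-monoˡ-≤-nonNeg a {{nonNegative 0≤a}} 0≤b)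

  *≤0ʳ : ∀ {a b} → 0ℚ ≤ a → b ≤ 0ℚ → a * b ≤ 0ℚ
  *≤0ʳ {a} {b} 0≤a b≤0 = ≤-trans (*-monoˡ-≤-nonNeg a {{nonNegative 0≤a}} b≤0) (≤-reflexive (*-zeroʳ a))

  *≤0ˡ : ∀ {a b} → a ≤ 0ℚ → 0ℚ ≤ b → a * b ≤ 0ℚ
  *≤0ˡ {a} {b} a≤0 0≤b = ≤-trans (≤-reflexive (*-comm a b)) (*≤0ʳ 0≤b a≤0)

  0≤^ : ∀ {x} k → 0ℚ ≤ x → 0ℚ ≤ x ^ k
  0≤^ zero    0≤x = nonNegative⁻¹ 1ℚ
  0≤^ (suc k) 0≤x = 0≤* 0≤x (0≤^ k 0≤x)

  ^-mono-≤ : ∀ {x y} k → 0ℚ ≤ x → x ≤ y → x ^ k ≤ y ^ k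
  ^-mono-≤ zero    0≤x x≤y = ≤-refl
  ^-mono-≤ (suc k) 0≤x x≤y = *-mono-≤₀ 0≤x (0≤^ k (≤-trans 0≤x x≤y)) x≤y (^-mono-≤ k 0≤x x≤y)

  ½^≤1 : ∀ k → ½ ^ k ≤ 1ℚ
  ½^≤1 zero    = ≤-refl
  ½^≤1 (suc k) = *-mono-≤₀ {b = 1ℚ} {d = 1ℚ} (0≤/ 1 2) (nonNegative⁻¹ 1ℚ) (/-mono-≤ 1 2 1 1 (s≤s z≤n)) (½^≤1 k)

  2^+≡ : ∀ k → 2^ (+ k) ≡ (2 ℕ.^ k) /1
  2^+≡ k = sym (/1-^ 2 k)

  2^-upper : ∀ {i} k → i ℤ.≤ + k → 2^ i ≤ (2 ℕ.^ k) /1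
  2^-upper {+ c}      k (ℤ.+≤+ c≤k) = ≤-trans (≤-reflexive (2^+≡ c)) (/1-mono-≤ (ℕ.^-monoʳ-≤ 2 c≤k))
  2^-upper { -[1+ c ]} k _           = ≤-trans (½^≤1 (suc c)) (/1-mono-≤ (ℕ.m^n>0 2 k))

  2^-lower : ∀ {i} k → + k ℤ.≤ i → (2 ℕ.^ k) /1 ≤ 2^ i
  2^-lower { + c} k (ℤ.+≤+ k≤c) = ≤-trans (/1-mono-≤ (ℕ.^-monoʳ-≤ 2 k≤c)) (≤-reflexive (sym (2^+≡ c)))

  -- Write `q` as a / b. If `k < q`, then k b ≤ a, hence r ^ b ≤ 2 ^ (k b) ≤ 2 ^ a, against the
  -- witness `r` of the cut. The proof of `log₂-upper` is the mirror image.
  log₂-lower : ∀ x k {q} → (∀ {r} → lower x r → r ≤ (2 ℕ.^ k) /1) → lower (log₂ x) q → q ≤ k /1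
  log₂-lower x k {q} x≤ (r , 0<r , xr , 2^<r^) with k /1 <? q
  ... | no k≮q  = ≮⇒≥ k≮q
  ... | yes k<q = contradiction (begin-strict
    2^ (↥ q)
      <⟨ 2^<r^ ⟩
    r ^ ↧ₙ q
      ≤⟨ ^-mono-≤ (↧ₙ q) (<⇒≤ 0<r) (x≤ xr) ⟩
    ((2 ℕ.^ k) /1) ^ ↧ₙ q
      ≡⟨ /1-^ (2 ℕ.^ k) (↧ₙ q) ⟨
    ((2 ℕ.^ k) ℕ.^ ↧ₙ q) /1
      ≡⟨ cong _/1 (ℕ.^-*-assoc 2 k (↧ₙ q)) ⟩
    (2 ℕ.^ (k ℕ.* ↧ₙ q)) /1
      ≤⟨ 2^-lower (k ℕ.* ↧ₙ q) (subst (ℤ._≤ ↥ q) (sym (ℤ.pos-* k (↧ₙ q))) (/1<⇒≤↥ k q k<q)) ⟩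
    2^ (↥ q) ∎) (<-irrefl refl)
    where open ≤-Reasoning

  log₂-upper : ∀ x k {q} → (∀ {r} → upper x r → (2 ℕ.^ k) /1 ≤ r) → upper (log₂ x) q → k /1 ≤ q
  log₂-upper x k {q} ≤x (r , 0<r , xr , r^<2^) with q <? k /1
  ... | no q≮k  = ≮⇒≥ q≮k
  ... | yes q<k = contradiction (begin-strict
    r ^ ↧ₙ q
      <⟨ r^<2^ ⟩
    2^ (↥ q)
      ≤⟨ 2^-upper (k ℕ.* ↧ₙ q) (subst (↥ q ℤ.≤_) (sym (ℤ.pos-* k (↧ₙ q))) (</1⇒↥≤ k q q<k)) ⟩
    (2 ℕ.^ (k ℕ.* ↧ₙ q)) /1
      ≡⟨ cong _/1 (ℕ.^-*-assoc 2 k (↧ₙ q)) ⟨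
    ((2 ℕ.^ k) ℕ.^ ↧ₙ q) /1
      ≡⟨ /1-^ (2 ℕ.^ k) (↧ₙ q) ⟩
    ((2 ℕ.^ k) /1) ^ ↧ₙ q
      ≤⟨ ^-mono-≤ (↧ₙ q) (0≤/ (2 ℕ.^ k) 1) (≤x xr) ⟩
    r ^ ↧ₙ q ∎) (<-irrefl refl)
    where open ≤-Reasoning

  -- The numerator is at most `E` (K + 1), as log n ≤ K + 1; the denominator is at least n J, as log
  -- log n ≥ J. Interval endpoints may be negative; in those cases one of the available products
  -- already gives a bound by 0.
  bound-≤ : ∀ {e E p n K J} → 2 ℕ.^ K ℕ.≤ n → n ℕ.≤ 2 ℕ.^ suc K → 2 ℕ.^ J ℕ.≤ K →
    1ℚ + e ≤ E → 0ℚ ≤ E → 0ℚ ≤ p → E * suc K /1 ≤ p * (n /1 * J /1) → bound e n ≤ᶜ ι p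
  -- The rational `a` lies below the numerator and `c` below the reciprocal of the denominator; `u`
  -- lies above the denominator and `l` below it.
  bound-≤ {e} {E} {p} {n} {K} {J} 2^K≤n n≤2^ 2^J≤K 1+e≤E 0≤E 0≤p EX≤ q
    (a , b , c , d , ((A , _ , C , D , (A<1+e , _ , logC , logD) , a<AC , a<AD , _) , _ ,
                      (u , (_ , N₂ , _ , H , (_ , n<N₂ , _ , loglogH) , _ , _ , _ , N₂H<u) , cu<1) ,
                      (l , 0<l , _ , 1<dl)) ,
     q<ac , q<ad , _)
    = by-sign
    where
    open ≤-Reasoning
    n′ = ι (n /1)

    logn-upper : ∀ {r} → upper (log₂ n′) r → K /1 ≤ r
    logn-upper = log₂-upper n′ K λ n<r → ≤-trans (/1-mono-≤ 2^K≤n) (<⇒≤ n<r)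

    0≤D : 0ℚ ≤ D
    0≤D = ≤-trans (0≤/ K 1) (logn-upper logD)

    C≤X : C ≤ suc K /1
    C≤X = log₂-lower n′ (suc K) (λ r<n → ≤-trans (<⇒≤ r<n) (/1-mono-≤ n≤2^)) logC

    J≤H : J /1 ≤ H
    J≤H = log₂-upper (log₂ n′) J (λ logr → ≤-trans (/1-mono-≤ 2^J≤K) (logn-upper logr)) loglogH

    A≤E : A ≤ E
    A≤E = ≤-trans (<⇒≤ A<1+e) 1+e≤E

    0≤X : 0ℚ ≤ suc K /1
    0≤X = 0≤/ (suc K) 1

    a≤EX : a ≤ E * suc K /1
    a≤EX with ≤-total A 0ℚ | ≤-total C 0ℚ
    -- Here the product with `D` is the useful one: `D` lies above log n and so is nonnegative,
    -- while `C` may have either sign.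
    ... | inj₁ A≤0 | _        = ≤-trans (<⇒≤ a<AD) (≤-trans (*≤0ˡ A≤0 0≤D) (0≤* 0≤E 0≤X))
    ... | inj₂ 0≤A | inj₁ C≤0 = ≤-trans (<⇒≤ a<AC) (≤-trans (*≤0ʳ 0≤A C≤0) (0≤* 0≤E 0≤X))
    ... | inj₂ 0≤A | inj₂ 0≤C = ≤-trans (<⇒≤ a<AC) (*-mono-≤₀ 0≤A 0≤X A≤E C≤X)

    nJ≤u : n /1 * J /1 ≤ u
    nJ≤u = ≤-trans (*-mono-≤₀ (0≤/ n 1) (≤-trans (0≤/ J 1) J≤H) (<⇒≤ n<N₂) J≤H) (<⇒≤ N₂H<u)

    0≤d : 0ℚ ≤ d
    0≤d with ≤-total d 0ℚ
    ... | inj₂ 0≤d = 0≤d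
    ... | inj₁ d≤0 = contradiction (<-≤-trans 1<dl (*≤0ˡ d≤0 (<⇒≤ 0<l))) λ 1<0 → <-irrefl refl (<-≤-trans 1<0 (nonNegative⁻¹ 1ℚ))

    by-sign : q < p
    by-sign with ≤-total a 0ℚ | ≤-total c 0ℚ
    ... | inj₁ a≤0 | _        = <-≤-trans q<ad (≤-trans (*≤0ˡ a≤0 0≤d) 0≤p)
    ... | inj₂ 0≤a | inj₁ c≤0 = <-≤-trans q<ac (≤-trans (*≤0ʳ 0≤a c≤0) 0≤p)
    ... | inj₂ 0≤a | inj₂ 0≤c = begin-strict
      q                        <⟨ q<ac ⟩
      a * c                    ≤⟨ *-mono-≤₀ 0≤a 0≤c (≤-trans a≤EX EX≤) ≤-refl ⟩
      p * (n /1 * J /1) * c    ≡⟨ *-assoc p (n /1 * J /1) c ⟩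
      p * ((n /1 * J /1) * c)  ≤⟨ *-mono-≤₀ 0≤p (nonNegative⁻¹ 1ℚ) (≤-refl {p}) nJc≤1 ⟩
      p * 1ℚ                   ≡⟨ *-identityʳ p ⟩
      p                        ∎
      where
      nJc≤1 : (n /1 * J /1) * c ≤ 1ℚ
      nJc≤1 = begin
        (n /1 * J /1) * c  ≤⟨ *-monoʳ-≤-nonNeg c {{nonNegative 0≤c}} nJ≤u ⟩
        u * c              ≡⟨ *-comm u c ⟩
        c * u              ≤⟨ <⇒≤ cu<1 ⟩
        1ℚ                 ∎

-- Integer logarithms and the choice of the number of targets.

module Estimates where

  open import Data.Nat
  open import Data.Nat.Properties
  open import Data.Nat.DivMod using (m/n*n≤m; m≡m%n+[m/n]*n; m%n<n)
  open import Data.Nat.Induction using (<-rec)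
  open import Data.Nat.Logarithm
    using (⌊log₂_⌋; ⌊log₂⌋-mono-≤; ⌊log₂⌊n/2⌋⌋≡⌊log₂n⌋∸1; ⌊log₂[2^n]⌋≡n)
  open import Data.Nat.Tactic.RingSolver using (solve-∀)
  open import Relation.Binary.PropositionalEquality using (_≡_; refl; sym; trans; cong)

  -- Strong induction: halving `n` lowers the logarithm by one, and twice the rounded half is at
  -- most `n`.
  2^⌊log₂n⌋≤n : ∀ n .{{_ : NonZero n}} → 2 ^ ⌊log₂ n ⌋ ≤ n
  2^⌊log₂n⌋≤n = <-rec (λ n → .{{_ : NonZero n}} → 2 ^ ⌊log₂ n ⌋ ≤ n) step
    where
    open ≤-Reasoning
    step : ∀ n → (∀ {m} → m < n → .{{_ : NonZero m}} → 2 ^ ⌊log₂ m ⌋ ≤ m) → .{{_ : NonZero n}} → 2 ^ ⌊log₂ n ⌋ ≤ n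
    step 1                 _   = ≤-refl
    step n@(suc (suc n-2)) rec = begin
      2 ^ ⌊log₂ n ⌋
        ≡⟨ cong (2 ^_) (trans (sym (m+[n∸m]≡n (⌊log₂⌋-mono-≤ {2} {n} (s≤s (s≤s z≤n))))) (cong suc (sym (⌊log₂⌊n/2⌋⌋≡⌊log₂n⌋∸1 n)))) ⟩
      2 * 2 ^ ⌊log₂ ⌊ n /2⌋ ⌋
        ≤⟨ *-monoʳ-≤ 2 (rec (⌊n/2⌋<n (suc n-2))) ⟩
      2 * ⌊ n /2⌋
        ≡⟨ cong (⌊ n /2⌋ +_) (+-identityʳ ⌊ n /2⌋) ⟩
      ⌊ n /2⌋ + ⌊ n /2⌋
        ≤⟨ +-monoʳ-≤ ⌊ n /2⌋ (⌊n/2⌋≤⌈n/2⌉ n) ⟩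
      ⌊ n /2⌋ + ⌈ n /2⌉
        ≡⟨ ⌊n/2⌋+⌈n/2⌉≡n n ⟩
      n ∎

  n<2^1+⌊log₂n⌋ : ∀ n → n < 2 ^ suc ⌊log₂ n ⌋
  n<2^1+⌊log₂n⌋ n = ≰⇒> λ 2^≤n → 1+n≰n (≤-trans (≤-reflexive (sym (⌊log₂[2^n]⌋≡n (suc ⌊log₂ n ⌋)))) (⌊log₂⌋-mono-≤ 2^≤n))

  n<2^n : ∀ n → n < 2 ^ n
  n<2^n zero    = s≤s z≤n
  n<2^n (suc n) = ≤-trans (+-mono-≤ (m^n>0 2 n) (n<2^n n)) (≤-reflexive (cong (2 ^ n +_) (sym (+-identityʳ _))))

  n*n≤2*2^n : ∀ n → n * n ≤ 2 * 2 ^ n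
  n*n≤2*2^n zero    = z≤n
  n*n≤2*2^n (suc n) = begin
    suc n * suc n                ≡⟨ square n ⟩
    n * n + (n + suc n)          ≤⟨ +-mono-≤ (n*n≤2*2^n n) (+-mono-≤ (<⇒≤ (n<2^n n)) (n<2^n n)) ⟩
    2 * 2 ^ n + (2 ^ n + 2 ^ n)  ≡⟨ double (2 ^ n) ⟩
    2 * 2 ^ suc n                ∎
    where
    open ≤-Reasoning
    square : ∀ n → (1 + n) * (1 + n) ≡ n * n + (n + (1 + n))
    square = solve-∀
    double : ∀ x → 2 * x + (x + x) ≡ 2 * (2 * x)
    double = solve-∀

  module _ (K J : ℕ) (2^J≤K : 2 ^ J ≤ K) where

    open ≤-Reasoning

    private
      -- `m` is the largest integer with m (J + 1) + J ≤ K. As m ^ m ≤ 2 ^ (m (J + 1)) for m ≤ 2 ^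
      -- (J + 1), this leaves a spare factor `Q` between `m ^ m` and `2 ^ K`.
      Q m : ℕ
      Q = 2 ^ J
      m = (K ∸ J) / suc J

    m*[1+J]≤K∸J : m * suc J ≤ K ∸ J
    m*[1+J]≤K∸J = m/n*n≤m (K ∸ J) (suc J)

    m≤K : m ≤ K
    m≤K = ≤-trans (m≤m*n m (suc J)) (≤-trans m*[1+J]≤K∸J (m∸n≤m K J))

    J≤K : J ≤ K
    J≤K = ≤-trans (<⇒≤ (n<2^n J)) 2^J≤K

    -- Rounding in the division loses at most `J`, on top of the `J` subtracted before it.
    K≤m*[1+J]+2J : K ≤ m * suc J + (J + J)
    K≤m*[1+J]+2J = begin
      K                                  ≤⟨ m≤n+m∸n K J ⟩
      J + (K ∸ J)                        ≡⟨ cong (J +_) (m≡m%n+[m/n]*n (K ∸ J) (suc J)) ⟩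
      J + ((K ∸ J) % suc J + m * suc J)  ≤⟨ +-monoʳ-≤ J (+-monoˡ-≤ _ (≤-pred (m%n<n (K ∸ J) (suc J)))) ⟩
      J + (J + m * suc J)                ≡⟨ rearrange J (m * suc J) ⟩
      m * suc J + (J + J)                ∎
      where
      rearrange : ∀ x y → x + (x + y) ≡ y + (x + x)
      rearrange = solve-∀

    -- Makes `m ^ m` negligible: n + m ^ m ≤ n (1 + 1 / Q) whenever 2 ^ K ≤ n.
    m^m*2^J≤2^K : K < 2 ^ suc J → m ^ m * Q ≤ 2 ^ K
    m^m*2^J≤2^K K<2^ = begin
      m ^ m * Q
        ≤⟨ *-monoˡ-≤ Q (^-monoˡ-≤ m (≤-trans m≤K (<⇒≤ K<2^))) ⟩
      (2 ^ suc J) ^ m * Q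
        ≡⟨ cong (_* Q) (^-*-assoc 2 (suc J) m) ⟩
      2 ^ (suc J * m) * Q
        ≡⟨ ^-distribˡ-+-* 2 (suc J * m) J ⟨
      2 ^ (suc J * m + J)
        ≤⟨ ^-monoʳ-≤ 2 (+-monoˡ-≤ J (≤-trans (≤-reflexive (*-comm (suc J) m)) m*[1+J]≤K∸J)) ⟩
      2 ^ (K ∸ J + J)
        ≡⟨ cong (2 ^_) (m∸n+n≡m J≤K) ⟩
      2 ^ K ∎

    -- The constant 8 absorbs the lower-order terms, which add up to at most
    -- 3 Q K + 4 Q K; this uses i ≤ J ≤ Q ≤ K and J² ≤ 2 Q.

    main-estimate : ∀ i → suc J ∸ 8 ≡ i → i * suc K * suc Q ≤ J * Q * (m * suc J)
    -- This is the case J ≤ 7, where the truncated main factor vanishes.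
    main-estimate zero      _  = z≤n
    -- Adding the rounding loss 2 J, scaled by J Q, to both sides lets `K≤m*[1+J]+2J` be applied
    -- without subtraction.
    main-estimate i@(suc _) eq = +-cancelʳ-≤ (J * Q * (J + J)) _ _ (begin
      i * suc K * suc Q + J * Q * (J + J)
        ≡⟨ expand i K Q J ⟩
      i * (K * Q) + (i * (K + Q + 1) + 2 * Q * (J * J))
        ≤⟨ +-monoʳ-≤ (i * (K * Q)) (+-mono-≤
             (*-mono-≤ i≤Q (+-mono-≤ (+-monoʳ-≤ K 2^J≤K) 1≤K))
             (*-monoʳ-≤ (2 * Q) (≤-trans (n*n≤2*2^n J) (*-monoʳ-≤ 2 2^J≤K)))) ⟩
      i * (K * Q) + (Q * (K + K + K) + 2 * Q * (2 * K))
        ≡⟨ collect i K Q ⟩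
      (i + 7) * Q * K
        ≡⟨ cong (λ z → z * Q * K) i+7≡J ⟩
      J * Q * K
        ≤⟨ *-monoʳ-≤ (J * Q) K≤m*[1+J]+2J ⟩
      J * Q * (m * suc J + (J + J))
        ≡⟨ *-distribˡ-+ (J * Q) (m * suc J) (J + J) ⟩
      J * Q * (m * suc J) + J * Q * (J + J) ∎)
      where
      i+7≡J : i + 7 ≡ J
      i+7≡J = trans (cong (_+ 7) (sym eq)) (m∸n+n≡m {J} {7} (<⇒≤ (m∸n≢0⇒n<m λ J∸7≡0 → 1+n≢0 (trans (sym eq) J∸7≡0))))

      i≤Q : i ≤ Q
      i≤Q = ≤-trans (≤-trans (m≤m+n i 7) (≤-reflexive i+7≡J)) (<⇒≤ (n<2^n J))

      1≤K : 1 ≤ K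
      1≤K = ≤-trans (m^n>0 2 J) 2^J≤K

      expand : ∀ i K Q J → i * (1 + K) * (1 + Q) + J * Q * (J + J)
             ≡ i * (K * Q) + (i * (K + Q + 1) + 2 * Q * (J * J))
      expand = solve-∀

      collect : ∀ i K Q → i * (K * Q) + (Q * (K + K + K) + 2 * Q * (2 * K)) ≡ (i + 7) * Q * K
      collect = solve-∀

    -- Here `s` counts successes among `D` outcomes. Then s / D ≥ m / (n + m ^ m) ≥ m Q / (n (1 +
    -- Q)), and `main-estimate` compares the last fraction with i (K + 1) / (n J (J + 1)).
    -- Everything is stated with denominators cleared.
    probability-estimate : ∀ n s D → m ^ m * Q ≤ n → m * D ≤ s * (n + m ^ m) →
      (suc J ∸ 8) * suc K * D ≤ s * (n * J) * suc J
    probability-estimate n s D MQ≤n mD≤ = *-cancelʳ-≤ _ _ (suc Q) (begin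
      i * suc K * D * suc Q            ≡⟨ swap-last (i * suc K) D (suc Q) ⟩
      i * suc K * suc Q * D            ≤⟨ *-monoˡ-≤ D (main-estimate i refl) ⟩
      J * Q * (m * suc J) * D          ≡⟨ regroup J Q m D ⟩
      J * suc J * Q * (m * D)          ≤⟨ *-monoʳ-≤ (J * suc J * Q) mD≤ ⟩
      J * suc J * Q * (s * (n + M))    ≡⟨ regroup′ J Q s n M ⟩
      J * suc J * s * (Q * n + M * Q)  ≤⟨ *-monoʳ-≤ (J * suc J * s) (+-monoʳ-≤ (Q * n) MQ≤n) ⟩
      J * suc J * s * (Q * n + n)      ≡⟨ regroup″ J s Q n ⟩
      s * (n * J) * suc J * suc Q      ∎)
      where
      i = suc J ∸ 8
      M = m ^ m

      swap-last : ∀ x y z → x * y * z ≡ x * z * y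
      swap-last = solve-∀

      regroup : ∀ J Q m D → J * Q * (m * (1 + J)) * D ≡ J * (1 + J) * Q * (m * D)
      regroup = solve-∀

      regroup′ : ∀ J Q s n M → J * (1 + J) * Q * (s * (n + M)) ≡ J * (1 + J) * s * (Q * n + M * Q)
      regroup′ = solve-∀

      regroup″ : ∀ J s Q n → J * (1 + J) * s * (Q * n + n) ≡ s * (n * J) * (1 + J) * (1 + Q)
      regroup″ = solve-∀

-- The error term and the assembly of the bound.

open Counting
open Cuts
open Estimates
open import Data.Nat as ℕ using (ℕ; _≤_; zero; suc; s≤s; z≤n; NonZero; _!)
import Data.Nat.Properties as ℕ
open import Data.Nat.Logarithm using (⌊log₂_⌋; ⌊log₂⌋-mono-≤; ⌊log₂[2^n]⌋≡n)
open import Data.Integer as ℤ using (+_; -[1+_])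
import Data.Integer.Properties as ℤ
open import Data.Fin using (Fin)
open import Data.List using (length)
open import Data.Rational as ℚ using (ℚ; mkℚ; -_; _/_)
import Data.Rational.Properties as ℚ
import Data.Rational.Unnormalised as ℚᵘ
import Data.Rational.Unnormalised.Properties as ℚᵘ
open import Data.Product using (Σ-syntax; _×_; _,_)
open import Relation.Nullary using (contradiction)
open import Relation.Binary.PropositionalEquality using (sym; trans; cong; subst; subst₂)

⌊loglog_⌋ : ℕ → ℕ
⌊loglog n ⌋ = ⌊log₂ ⌊log₂ n ⌋ ⌋

-- Chosen so that 1 + `error n` is at most (suc J ∸ 8) / (J + 1), the factor in
-- `probability-estimate`.
error : ℕ → ℚ
error n = - (+ 8 / suc ⌊loglog n ⌋)

error-tends-to-zero : TendsToZero error
error-tends-to-zero (mkℚ (+ zero) _ _) 0<ε = contradiction (ℚ.drop-*<* 0<ε) λ { (ℤ.+<+ ()) }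
error-tends-to-zero (mkℚ -[1+ _ ] _ _) 0<ε = contradiction (ℚ.drop-*<* 0<ε) λ ()
-- For ε with denominator d, take t = 8 d. From n ≥ 2 ^ (2 ^ t) on, the double logarithm is at least
-- t, and 8 / (t + 1) < 1 / d ≤ ε.
error-tends-to-zero ε@(mkℚ (+ suc k) d-1 _) 0<ε = 2 ℕ.^ (2 ℕ.^ t) , λ n N≤n →
  subst (ℚ._< ε) (sym (trans (ℚ.∣-p∣≡∣p∣ (+ 8 / suc ⌊loglog n ⌋)) (ℚ.0≤p⇒∣p∣≡p (0≤/ 8 (suc ⌊loglog n ⌋)))))
    (ℚ.toℚᵘ-cancel-< (ℚᵘ.<-respˡ-≃ (ℚᵘ.≃-sym (toℚᵘ-/ (+ 8) (suc ⌊loglog n ⌋)))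
      (ℚᵘ.*<* (subst₂ ℤ._<_ (ℤ.pos-* 8 (suc d-1)) (ℤ.pos-* (suc k) (suc ⌊loglog n ⌋)) (ℤ.+<+ (small n N≤n))))))
  where
  t = 8 ℕ.* suc d-1
  small : ∀ n → 2 ℕ.^ (2 ℕ.^ t) ℕ.≤ n → t ℕ.< suc k ℕ.* suc ⌊loglog n ⌋
  small n N≤n = ℕ.≤-trans (s≤s (ℕ.≤-trans (ℕ.≤-reflexive (sym (trans (cong ⌊log₂_⌋ (⌊log₂[2^n]⌋≡n (2 ℕ.^ t))) (⌊log₂[2^n]⌋≡n t))))
    (⌊log₂⌋-mono-≤ (⌊log₂⌋-mono-≤ N≤n)))) (ℕ.m≤m+n (suc ⌊loglog n ⌋) _)

mainTheorem3 : Σ[ o ∈ (ℕ → ℚ) ] (TendsToZero o ×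
    ((n : ℕ) → 3 ≤ n →
    Σ[ R ∈ RandomizedStrategy n ]
    ((s : Fin n) → bound (o n) n ≤ᶜ ι (successProbability R s))))
mainTheorem3 = error , error-tends-to-zero , λ n 3≤n →
  let K       = ⌊log₂ n ⌋
      J       = ⌊loglog n ⌋
      m       = (K ℕ.∸ J) ℕ./ suc J
      i       = suc J ℕ.∸ 8
      -- `K` has to be nonzero for 2 ^ J ≤ K.
      1≤K     = ⌊log₂⌋-mono-≤ {2} {n} (ℕ.≤-trans (ℕ.n≤1+n 2) 3≤n)
      2^K≤n   = 2^⌊log₂n⌋≤n n {{ℕ.>-nonZero (ℕ.≤-trans (s≤s z≤n) 3≤n)}}
      2^J≤K   = 2^⌊log₂n⌋≤n K {{ℕ.>-nonZero 1≤K}}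
      m<n     = ℕ.≤-trans (s≤s (m≤K K J 2^J≤K)) (ℕ.≤-trans (n<2^n K) 2^K≤n)
      R , D≤s = good-strategy n m m<n (ℕ.≤-trans (ℕ.n≤1+n 2) 3≤n)
      m^m≤    = ℕ.≤-trans (m^m*2^J≤2^K K J 2^J≤K (n<2^1+⌊log₂n⌋ K)) 2^K≤n
  in R , λ s →
    let D = RandomizedStrategy.seeds R ℕ.* n !
        S = length (successes R s)
        instance
          D≢0 : NonZero D
          D≢0 = ℕ.m*n≢0 (RandomizedStrategy.seeds R) (n !) {{RandomizedStrategy.seedsNonZero R}} {{n ℕ.!≢0}}
          D*1≢0 : NonZero (D ℕ.* 1)
          D*1≢0 = ℕ.m*n≢0 D 1
    in bound-≤ {error n} {+ i / suc J} {successProbability R s} {n} {K} {J}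
        2^K≤n (ℕ.<⇒≤ (n<2^1+⌊log₂n⌋ n)) 2^J≤K
        (1-/≤ 8 (suc J)) (0≤/ i (suc J)) (0≤/ S D)
        (subst₂ ℚ._≤_
          (sym (/-* i (suc J) (suc K) 1))
          (trans (sym (/-* S D (n ℕ.* J) 1)) (cong (successProbability R s ℚ.*_) (/1-* n J)))
          -- The factors 1 in the denominators come from the integers K + 1 and n J, written as
          -- fractions over 1.
          (/-mono-≤ (i ℕ.* suc K) (suc J ℕ.* 1) (S ℕ.* (n ℕ.* J)) (D ℕ.* 1)
            (subst₂ _≤_ (cong (i ℕ.* suc K ℕ.*_) (sym (ℕ.*-identityʳ D)))
                        (cong (S ℕ.* (n ℕ.* J) ℕ.*_) (sym (ℕ.*-identityʳ (suc J))))
              (probability-estimate K J 2^J≤K n S D m^m≤ (D≤s s)))))
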